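{- For every function $f:\mathbb{N}\to\mathbb{Z}$ there exists a function $g:\mathbb{N}\to\mathbb{Z}$ which has integral difference ratios and such that, for all $x\in\mathbb{N}$, $$0\leq f(x)-g(x)\leq 2^x\,\mathrm{lcm}(x).$$ In particular, if there is some $\varepsilon>0$ such that $|f(x)|\geq(2e+\varepsilon)^x$ for all $x$ large enough, then $\lim_{x\to+\infty}\dfrac{f(x)}{g(x)}=1$, i.e. $f$ and $g$ are asymptotically equivalent.
   Context: $\mathbb{N}$ denotes the non-negative integers. For $k\geq 1$, $\mathrm{lcm}(k)$ is the least common multiple of all positive integers less than or equal to $k$; by convention $\mathrm{lcm}(0)=1$. Here $e$ is the base of the natural logarithm. A function $f:\mathbb{N}\to\mathbb{Z}$ has integral difference ratios if $a-b$ divides $f(a)-f(b)$ for all $a,b\in\mathbb{N}$ with $a\neq b$. -}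

module Defs where

open import Data.Nat as ℕ using (ℕ; zero; suc; _!)
import Data.Nat.Properties as ℕ
open import Data.Nat.Solver renaming (module +-*-Solver to ℕ-Solver)
open import Data.Nat.LCM using (lcm)
open import Data.Integer as ℤ using (ℤ; +_; +[1+_])
import Data.Integer.Properties as ℤ
open import Data.Integer.Divisibility.Signed using (_∣_)
open import Data.Rational
open import Data.Rational.Literals using (fromℤ)
open import Data.Rational.Properties
import Data.Rational.Unnormalised as ℚᵘ
import Data.Rational.Unnormalised.Properties as ℚᵘ
open import Data.Rational.Solver using (module +-*-Solver)
open import Data.Product using (Σ-syntax; ∃-syntax; _×_; _,_; proj₁; proj₂)
open import Data.Sum using (inj₁; inj₂)
open import Relation.Binary.PropositionalEquality

Eventually : (ℕ → Set) → Set
Eventually P = ∃[ N ] (∀ n → N ℕ.≤ n → P n)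

lcmUpTo : ℕ → ℕ
lcmUpTo zero    = 1
lcmUpTo (suc k) = lcm (suc k) (lcmUpTo k)

IntegralDifferenceRatios : (ℕ → ℤ) → Set
IntegralDifferenceRatios f =
  ∀ (a b : ℕ) → a ≢ b → ((+ a) ℤ.- (+ b)) ∣ (f a ℤ.- f b)

-- Real numbers are Cauchy sequences of rationals.  No quotient is taken:
-- the order relations below do not depend on the representatives.

IsCauchy : (ℕ → ℚ) → Set
IsCauchy x = ∀ δ → 0ℚ < δ →
  ∃[ N ] (∀ m n → N ℕ.≤ m → N ℕ.≤ n → ∣ x m - x n ∣ < δ)

record ℝ : Set where
  constructor mkℝ
  field
    approx : ℕ → ℚ
    cauchy : IsCauchy approx

open ℝ public

infix 4 _≤ℝ_ _<ℝ_

_≤ℝ_ : ℝ → ℝ → Set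
x ≤ℝ y = ∀ δ → 0ℚ < δ → Eventually (λ n → approx x n ≤ approx y n + δ)

_<ℝ_ : ℝ → ℝ → Set
x <ℝ y = ∃[ δ ] (0ℚ < δ × Eventually (λ n → approx x n + δ ≤ approx y n))

private
  half+half : ∀ q → ½ * q + ½ * q ≡ q
  half+half q = trans (sym (*-distribʳ-+ q ½ ½)) (*-identityˡ q)

  half-pos : ∀ {q} → 0ℚ < q → 0ℚ < ½ * q
  half-pos {q} 0<q = subst (_< ½ * q) (*-zeroʳ ½) (*-monoʳ-<-pos ½ 0<q)

  const-cauchy : ∀ q → IsCauchy (λ _ → q)
  const-cauchy q δ 0<δ = 0 , λ _ _ _ _ →
    subst (_< δ) (cong ∣_∣ (sym (+-inverseʳ q))) 0<δ

  +-cauchy : ∀ {x y} → IsCauchy x → IsCauchy y → IsCauchy (λ n → x n + y n)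
  +-cauchy {x} {y} cx cy δ 0<δ =
    let (M , hx) = cx (½ * δ) (half-pos 0<δ)
        (N , hy) = cy (½ * δ) (half-pos 0<δ)
    in M ℕ.⊔ N , λ m n Nm Nn → begin-strict
      ∣ (x m + y m) - (x n + y n) ∣
        ≡⟨ cong ∣_∣ (rearrange (x m) (y m) (x n) (y n)) ⟩
      ∣ (x m - x n) + (y m - y n) ∣
        ≤⟨ ∣p+q∣≤∣p∣+∣q∣ (x m - x n) (y m - y n) ⟩
      ∣ x m - x n ∣ + ∣ y m - y n ∣
        <⟨ +-mono-< (hx m n (ℕ.m⊔n≤o⇒m≤o M N Nm) (ℕ.m⊔n≤o⇒m≤o M N Nn))
                    (hy m n (ℕ.m⊔n≤o⇒n≤o M N Nm) (ℕ.m⊔n≤o⇒n≤o M N Nn)) ⟩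
      ½ * δ + ½ * δ
        ≡⟨ half+half δ ⟩
      δ ∎
    where
    open ≤-Reasoning
    open +-*-Solver
    rearrange : ∀ a b c d → (a + b) - (c + d) ≡ (a - c) + (b - d)
    rearrange = solve 4 (λ a b c d →
      (a :+ b) :- (c :+ d) := (a :- c) :+ (b :- d)) refl

  bounded : ∀ {x} → IsCauchy x →
    ∃[ B ] (0ℚ < B × Eventually (λ n → ∣ x n ∣ ≤ B))
  bounded {x} cx =
    let (N , h) = cx 1ℚ (positive⁻¹ 1ℚ)
    in 1ℚ + ∣ x N ∣
     , +-mono-<-≤ (positive⁻¹ 1ℚ) (0≤∣p∣ (x N))
     , N , λ n Nn → begin
      ∣ x n ∣                   ≡⟨ cong ∣_∣ (split (x n) (x N)) ⟩
      ∣ (x n - x N) + x N ∣     ≤⟨ ∣p+q∣≤∣p∣+∣q∣ (x n - x N) (x N) ⟩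
      ∣ x n - x N ∣ + ∣ x N ∣   ≤⟨ +-monoˡ-≤ ∣ x N ∣ (<⇒≤ (h n N Nn ℕ.≤-refl)) ⟩
      1ℚ + ∣ x N ∣              ∎
    where
    open ≤-Reasoning
    open +-*-Solver
    split : ∀ a b → a ≡ (a - b) + b
    split = solve 2 (λ a b → a := (a :- b) :+ b) refl

  -- Given B > 0, turn closeness within δ / B into closeness within δ.
  scale : ∀ {B δ} → 0ℚ < B → 0ℚ < δ →
    ∃[ η ] (0ℚ < η × (∀ {p q} → ∣ p ∣ ≤ B → ∣ q ∣ < η → ∣ p * q ∣ < δ))
  scale {B} {δ} 0<B 0<δ = η , 0<η , λ {p} {q} p≤B q<η → begin-strict
      ∣ p * q ∣       ≡⟨ ∣p*q∣≡∣p∣*∣q∣ p q ⟩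
      ∣ p ∣ * ∣ q ∣   ≤⟨ *-monoʳ-≤-nonNeg ∣ q ∣ ⦃ ∣-∣-nonNeg q ⦄ p≤B ⟩
      B * ∣ q ∣       <⟨ *-monoʳ-<-pos B q<η ⟩
      B * (1/ B * δ)  ≡⟨ *-assoc B (1/ B) δ ⟨
      B * 1/ B * δ    ≡⟨ cong (_* δ) (*-inverseʳ B) ⟩
      1ℚ * δ          ≡⟨ *-identityˡ δ ⟩
      δ               ∎
    where
    open ≤-Reasoning
    instance
      B-pos : Positive B
      B-pos = positive 0<B
      B-nonZero : NonZero B
      B-nonZero = pos⇒nonZero B
      1/B-pos : Positive (1/ B)
      1/B-pos = 1/pos⇒pos B
    η : ℚ
    η = 1/ B * δ
    0<η : 0ℚ < η
    0<η = subst (_< η) (*-zeroʳ (1/ B)) (*-monoʳ-<-pos (1/ B) 0<δ)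

  *-cauchy : ∀ {x y} → IsCauchy x → IsCauchy y → IsCauchy (λ n → x n * y n)
  *-cauchy {x} {y} cx cy δ 0<δ =
    let (A , 0<A , K , hA) = bounded {x} cx
        (B , 0<B , L , hB) = bounded {y} cy
        (α , 0<α , sA)     = scale 0<A (half-pos 0<δ)
        (β , 0<β , sB)     = scale 0<B (half-pos 0<δ)
        (M , hx)           = cx β 0<β
        (N , hy)           = cy α 0<α
    in (K ℕ.⊔ L) ℕ.⊔ (M ℕ.⊔ N) , λ m n Nm Nn →
      let KLm = ℕ.m⊔n≤o⇒m≤o (K ℕ.⊔ L) (M ℕ.⊔ N) Nm
          KLn = ℕ.m⊔n≤o⇒m≤o (K ℕ.⊔ L) (M ℕ.⊔ N) Nn
          MNm = ℕ.m⊔n≤o⇒n≤o (K ℕ.⊔ L) (M ℕ.⊔ N) Nm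
          MNn = ℕ.m⊔n≤o⇒n≤o (K ℕ.⊔ L) (M ℕ.⊔ N) Nn
      in begin-strict
      ∣ x m * y m - x n * y n ∣
        ≡⟨ cong ∣_∣ (rearrange (x m) (y m) (x n) (y n)) ⟩
      ∣ x m * (y m - y n) + y n * (x m - x n) ∣
        ≤⟨ ∣p+q∣≤∣p∣+∣q∣ (x m * (y m - y n)) (y n * (x m - x n)) ⟩
      ∣ x m * (y m - y n) ∣ + ∣ y n * (x m - x n) ∣
        <⟨ +-mono-<
             (sA {x m} {y m - y n} (hA m (ℕ.m⊔n≤o⇒m≤o K L KLm))
               (hy m n (ℕ.m⊔n≤o⇒n≤o M N MNm) (ℕ.m⊔n≤o⇒n≤o M N MNn)))
             (sB {y n} {x m - x n} (hB n (ℕ.m⊔n≤o⇒n≤o K L KLn))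
               (hx m n (ℕ.m⊔n≤o⇒m≤o M N MNm) (ℕ.m⊔n≤o⇒m≤o M N MNn))) ⟩
      ½ * δ + ½ * δ
        ≡⟨ half+half δ ⟩
      δ ∎
    where
    open ≤-Reasoning
    open +-*-Solver
    rearrange : ∀ a b c d → a * b - c * d ≡ a * (b - d) + d * (a - c)
    rearrange = solve 4 (λ a b c d →
      a :* b :- c :* d := a :* (b :- d) :+ d :* (a :- c)) refl

infixl 6 _+ℝ_
infixl 7 _*ℝ_
infixr 8 _^ℝ_

fromℚ : ℚ → ℝ
fromℚ q = mkℝ (λ _ → q) (const-cauchy q)

_+ℝ_ : ℝ → ℝ → ℝ
mkℝ x cx +ℝ mkℝ y cy = mkℝ (λ n → x n + y n) (+-cauchy {x} {y} cx cy)

_*ℝ_ : ℝ → ℝ → ℝ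
mkℝ x cx *ℝ mkℝ y cy = mkℝ (λ n → x n * y n) (*-cauchy {x} {y} cx cy)

_^ℝ_ : ℝ → ℕ → ℝ
x ^ℝ zero  = fromℚ 1ℚ
x ^ℝ suc n = x *ℝ x ^ℝ n

0ℝ 2ℝ : ℝ
0ℝ = fromℚ 0ℚ
2ℝ = fromℚ (fromℤ (+ 2))

fromℤℝ : ℤ → ℝ
fromℤℝ z = fromℚ (fromℤ z)

inv! : ℕ → ℚ
inv! n = (+ 1 / (n !)) ⦃ n ℕ.!≢0 ⦄

-- The partial sums 1/0! + 1/1! + ⋯ + 1/n!.
expSum : ℕ → ℚ
expSum zero    = inv! 0
expSum (suc n) = expSum n + inv! (suc n)

private
  /-toℚᵘ : ∀ z n .⦃ _ : ℕ.NonZero n ⦄ → toℚᵘ (z / n) ℚᵘ.≃ (z ℚᵘ./ n)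
  /-toℚᵘ z (suc n) = toℚᵘ-fromℚᵘ (ℚᵘ.mkℚᵘ z n)

  /-mono : ∀ {m n} .⦃ _ : ℕ.NonZero m ⦄ .⦃ _ : ℕ.NonZero n ⦄ →
    m ℕ.≤ n → + 1 / n ≤ + 1 / m
  /-mono {m@(suc m-1)} {n@(suc n-1)} m≤n = toℚᵘ-cancel-≤ (begin
      toℚᵘ (+ 1 / n)    ≃⟨ /-toℚᵘ (+ 1) n ⟩
      (+ 1) ℚᵘ./ n      ≤⟨ ℚᵘ.*≤* (ℤ.*-monoˡ-≤-nonNeg (+ 1) (ℤ.+≤+ m≤n)) ⟩
      (+ 1) ℚᵘ./ m      ≃⟨ /-toℚᵘ (+ 1) m ⟨
      toℚᵘ (+ 1 / m)    ∎)
    where open ℚᵘ.≤-Reasoning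

  /-double : ∀ n .⦃ _ : ℕ.NonZero n ⦄ .⦃ _ : ℕ.NonZero (2 ℕ.* n) ⦄ →
    + 1 / (2 ℕ.* n) + + 1 / (2 ℕ.* n) ≡ + 1 / n
  /-double n@(suc n-1) = toℚᵘ-injective (begin-equality
      toℚᵘ (h + h)                              ≃⟨ toℚᵘ-homo-+ h h ⟩
      toℚᵘ h ℚᵘ.+ toℚᵘ h                        ≃⟨ ℚᵘ.+-cong (/-toℚᵘ (+ 1) (2 ℕ.* n)) (/-toℚᵘ (+ 1) (2 ℕ.* n)) ⟩
      (+ 1) ℚᵘ./ (2 ℕ.* n) ℚᵘ.+ (+ 1) ℚᵘ./ (2 ℕ.* n)
                                                ≃⟨ ℚᵘ.*≡* (cong +_ (arith n)) ⟩
      (+ 1) ℚᵘ./ n                              ≃⟨ /-toℚᵘ (+ 1) n ⟨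
      toℚᵘ (+ 1 / n)                            ∎)
    where
    open ℚᵘ.≤-Reasoning
    open ℕ-Solver
    h : ℚ
    h = + 1 / (2 ℕ.* n)
    arith : ∀ n → (1 ℕ.* (2 ℕ.* n) ℕ.+ 1 ℕ.* (2 ℕ.* n)) ℕ.* n
                ≡ 1 ℕ.* ((2 ℕ.* n) ℕ.* (2 ℕ.* n))
    arith = solve 1 (λ n →
      (con 1 :* (con 2 :* n) :+ con 1 :* (con 2 :* n)) :* n
        := con 1 :* ((con 2 :* n) :* (con 2 :* n))) refl

  0≤inv! : ∀ n → 0ℚ ≤ inv! n
  0≤inv! n = nonNegative⁻¹ (inv! n)
    ⦃ normalize-nonNeg 1 (n !) ⦃ n ℕ.!≢0 ⦄ ⦄

  inv!-halves : ∀ n → 1 ℕ.≤ n → inv! (suc n) + inv! (suc n) ≤ inv! n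
  inv!-halves n 1≤n = begin
      inv! (suc n) + inv! (suc n)                     ≤⟨ +-mono-≤ le le ⟩
      + 1 / (2 ℕ.* n !) + + 1 / (2 ℕ.* n !)       ≡⟨ /-double (n !) ⟩
      inv! n                                      ∎
    where
    open ≤-Reasoning
    instance
      n!≢0 : ℕ.NonZero (n !)
      n!≢0 = n ℕ.!≢0
      sn!≢0 : ℕ.NonZero (suc n !)
      sn!≢0 = suc n ℕ.!≢0
      2n!≢0 : ℕ.NonZero (2 ℕ.* n !)
      2n!≢0 = ℕ.m*n≢0 2 (n !)
    le : inv! (suc n) ≤ + 1 / (2 ℕ.* n !)
    le = /-mono {2 ℕ.* n !} {suc n !} (ℕ.*-monoˡ-≤ (n !) (ℕ.s≤s 1≤n))

  expSum-lower : ∀ {N n} → N ℕ.≤′ n → expSum N ≤ expSum n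
  expSum-lower (ℕ.≤′-reflexive refl) = ≤-refl
  expSum-lower {N} (ℕ.≤′-step {n} N≤n) = begin
      expSum N                ≤⟨ expSum-lower N≤n ⟩
      expSum n                ≡⟨ +-identityʳ (expSum n) ⟨
      expSum n + 0ℚ           ≤⟨ +-monoʳ-≤ (expSum n) (0≤inv! (suc n)) ⟩
      expSum (suc n)          ∎
    where open ≤-Reasoning

  expSum-upper′ : ∀ {N n} → 1 ℕ.≤ N → N ℕ.≤′ n →
    expSum n + inv! n ≤ expSum N + inv! N
  expSum-upper′ 1≤N (ℕ.≤′-reflexive refl) = ≤-refl
  expSum-upper′ {N} 1≤N (ℕ.≤′-step {n} N≤n) = begin
      expSum n + inv! (suc n) + inv! (suc n)    ≡⟨ +-assoc (expSum n) _ _ ⟩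
      expSum n + (inv! (suc n) + inv! (suc n))  ≤⟨ +-monoʳ-≤ (expSum n)
                                                 (inv!-halves n (ℕ.≤-trans 1≤N (ℕ.≤′⇒≤ N≤n))) ⟩
      expSum n + inv! n                     ≤⟨ expSum-upper′ 1≤N N≤n ⟩
      expSum N + inv! N                     ∎
    where open ≤-Reasoning

  expSum-upper : ∀ {N n} → 1 ℕ.≤ N → N ℕ.≤ n → expSum n ≤ expSum N + inv! N
  expSum-upper {N} {n} 1≤N N≤n = begin
      expSum n            ≡⟨ +-identityʳ (expSum n) ⟨
      expSum n + 0ℚ       ≤⟨ +-monoʳ-≤ (expSum n) (0≤inv! n) ⟩
      expSum n + inv! n   ≤⟨ expSum-upper′ 1≤N (ℕ.≤⇒≤′ N≤n) ⟩
      expSum N + inv! N   ∎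
    where open ≤-Reasoning

  n≤n! : ∀ n → n ℕ.≤ n !
  n≤n! zero    = ℕ.z≤n
  n≤n! (suc n) = ℕ.m≤m*n (suc n) (n !) ⦃ n ℕ.!≢0 ⦄

  inv!-small : ∀ δ → 0ℚ < δ → ∃[ N ] (1 ℕ.≤ N × inv! N < δ)
  inv!-small δ@(mkℚ (+ zero) d _) (*<* (ℤ.+<+ ()))
  inv!-small δ@(mkℚ ℤ.-[1+ a ] d _) (*<* ())
  inv!-small δ@(mkℚ +[1+ a ] d _) 0<δ = N , ℕ.s≤s ℕ.z≤n , ≤-<-trans
      (/-mono {N} {N !} ⦃ _ ⦄ ⦃ N ℕ.!≢0 ⦄ (n≤n! N))
      (toℚᵘ-cancel-< (ℚᵘ.<-respˡ-≃ (ℚᵘ.≃-sym (/-toℚᵘ (+ 1) N))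
        (ℚᵘ.*<* (ℤ.+<+ (ℕ.≤-<-trans (ℕ.≤-reflexive (ℕ.*-identityˡ (suc d)))
          (ℕ.<-≤-trans (ℕ.n<1+n (suc d)) (ℕ.m≤n*m N (suc a))))))))
    where
    N : ℕ
    N = suc (suc d)

  within : ∀ {a b c r} → c ≤ a → a ≤ c + r → c ≤ b → b ≤ c + r → ∣ a - b ∣ ≤ r
  within {a} {b} {c} {r} c≤a a≤c+r c≤b b≤c+r with ∣p∣≡p∨∣p∣≡-p (a - b)
  ... | inj₁ eq = begin
      ∣ a - b ∣       ≡⟨ eq ⟩
      a - b           ≤⟨ +-mono-≤ a≤c+r (neg-antimono-≤ c≤b) ⟩
      (c + r) - c     ≡⟨ cancel c r ⟩
      r               ∎
    where
    open ≤-Reasoning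
    open +-*-Solver
    cancel : ∀ c r → (c + r) - c ≡ r
    cancel = solve 2 (λ c r → (c :+ r) :- c := r) refl
  ... | inj₂ eq = begin
      ∣ a - b ∣       ≡⟨ eq ⟩
      - (a - b)       ≡⟨ swap a b ⟩
      b - a           ≤⟨ +-mono-≤ b≤c+r (neg-antimono-≤ c≤a) ⟩
      (c + r) - c     ≡⟨ cancel c r ⟩
      r               ∎
    where
    open ≤-Reasoning
    open +-*-Solver
    swap : ∀ a b → - (a - b) ≡ b - a
    swap = solve 2 (λ a b → :- (a :- b) := b :- a) refl
    cancel : ∀ c r → (c + r) - c ≡ r
    cancel = solve 2 (λ c r → (c :+ r) :- c := r) refl

  expSum-cauchy : IsCauchy expSum
  expSum-cauchy δ 0<δ =
    let (N , 1≤N , small) = inv!-small δ 0<δ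
    in N , λ m n Nm Nn → ≤-<-trans
      (within (expSum-lower (ℕ.≤⇒≤′ Nm)) (expSum-upper 1≤N Nm)
              (expSum-lower (ℕ.≤⇒≤′ Nn)) (expSum-upper 1≤N Nn))
      small

e : ℝ
e = mkℝ expSum expSum-cauchy

_÷ℤ_ : (i j : ℤ) .⦃ _ : ℤ.NonZero j ⦄ → ℚ
i ÷ℤ j = fromℤ i ÷ fromℤ j

-- f(x)/g(x) → 1.  The quotient is only required to be defined for large x;
-- as it is rational, rational tolerances δ suffice.
AsymptoticallyEquivalent : (f g : ℕ → ℤ) → Set
AsymptoticallyEquivalent f g = ∀ δ → 0ℚ < δ → Eventually λ x →
  Σ[ nz ∈ ℤ.NonZero (g x) ] ∣ _÷ℤ_ (f x) (g x) ⦃ nz ⦄ - 1ℚ ∣ < δ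

{-# OPTIONS --safe #-}
-- Newton expansion: Σ_k c_k (n C k) has integral difference ratios as soon as lcm(k) divides
-- every c_k.  Choosing c_0, c_1, … greedily, each c_n is free up to a multiple of lcm(n), so
-- g(n) can be brought within lcm(n) below f(n).
--
-- The divisibility behind this, d ∣ L ((b + d) C k − b C k) for L a common multiple of 1, …, k,
-- also shows lcm(j + d) ∣ lcm(j) ((j + d) C j) for d ≤ j (take b < j, where b C j = 0), whence
-- lcm(n) ≤ 4ⁿ by halving.  As 2e > 5, the error is negligible against |f(x)| ≥ (2e + ε)ˣ.
module Submission where

open import Defs
open import Data.Nat using (ℕ; _*_; _^_)
open import Data.Integer using (ℤ; +_; 0ℤ; _-_; _≤_; ∣_∣)
open import Data.Product using (Σ-syntax; ∃-syntax; _×_)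
open import Data.Product using (_,_)
open import Data.Sum using (inj₁; inj₂)
open import Data.Nat as ℕ using (zero; suc; _!; z≤n; s≤s; ⌊_/2⌋; ⌈_/2⌉)
import Data.Nat.Properties as ℕ
import Data.Nat.Divisibility as ℕ
open import Data.Nat.Combinatorics using (_C_; nCk≡nC[n∸k]; nCn≡1; nC1≡n; k>n⇒nCk≡0; nCk+nC[k+1]≡[n+1]C[k+1])
open import Data.Nat.Coprimality using (Coprime)
open import Data.Nat.Induction using (<-rec)
open import Data.Nat.GCD using (gcd)
open import Data.Nat.LCM using (m∣lcm[m,n]; n∣lcm[m,n]; lcm-least; gcd*lcm)
open import Data.Nat.Solver using () renaming (module +-*-Solver to ℕ-Solver)
import Data.Integer as ℤ
import Data.Integer.Properties as ℤ
open import Data.Integer.DivMod using (_/ℕ_; _%ℕ_; n%ℕd<d; a≡a%ℕn+[a/ℕn]*n)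
open import Data.Integer.Divisibility.Signed using (_∣_; divides; ∣ᵤ⇒∣; ∣⇒∣ᵤ; ∣m∣n⇒∣m+n; ∣n⇒∣m*n)
open import Data.Integer.Solver using () renaming (module +-*-Solver to ℤ-Solver)
open import Data.Rational as ℚ using (ℚ; mkℚ; 0ℚ; 1ℚ)
import Data.Rational.Properties as ℚ
open import Data.Rational.Literals using (fromℤ)
import Data.Rational.Unnormalised as ℚᵘ
import Data.Rational.Unnormalised.Properties as ℚᵘ
open import Data.Rational.Solver using () renaming (module +-*-Solver to ℚ-Solver)
open import Relation.Binary.Definitions using (tri<; tri≈; tri>)
open import Relation.Binary.PropositionalEquality
open import Relation.Nullary using (contradiction)

-- Binomial coefficients

nC0≡1 : ∀ n → n C 0 ≡ 1
nC0≡1 n = trans (nCk≡nC[n∸k] {k = 0} {n = n} z≤n) (nCn≡1 n)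

-- Absorption identity, by induction along Pascal's rule: once one copy of `A` is split off, the two
-- induction hypotheses add up to (n + 1) `A`.
[k+1]*[n+1]C[k+1]≡[n+1]*nCk : ∀ n k → suc k * (suc n C suc k) ≡ suc n * (n C k)
[k+1]*[n+1]C[k+1]≡[n+1]*nCk n zero = begin
  1 * (suc n C 1)  ≡⟨ ℕ.*-identityˡ (suc n C 1) ⟩
  suc n C 1        ≡⟨ nC1≡n (suc n) ⟩
  suc n            ≡⟨ ℕ.*-identityʳ (suc n) ⟨
  suc n * 1        ≡⟨ cong (suc n *_) (nC0≡1 n) ⟨
  suc n * (n C 0)  ∎
  where open ≡-Reasoning
[k+1]*[n+1]C[k+1]≡[n+1]*nCk zero (suc k) = begin
  suc (suc k) * (1 C suc (suc k))  ≡⟨ cong (suc (suc k) *_) (k>n⇒nCk≡0 {k = suc (suc k)} (s≤s (s≤s z≤n))) ⟩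
  suc (suc k) * 0                  ≡⟨ ℕ.*-zeroʳ (suc (suc k)) ⟩
  0                                ≡⟨ cong (1 *_) (k>n⇒nCk≡0 {k = suc k} (s≤s z≤n)) ⟨
  1 * (0 C suc k)                  ∎
  where open ≡-Reasoning
[k+1]*[n+1]C[k+1]≡[n+1]*nCk (suc n) (suc k) = begin
  suc (suc k) * (suc (suc n) C suc (suc k))
    ≡⟨ cong (suc (suc k) *_) (nCk+nC[k+1]≡[n+1]C[k+1] (suc n) (suc k)) ⟨
  suc (suc k) * (A ℕ.+ B)
    ≡⟨ split k A B ⟩
  A ℕ.+ (suc k * A ℕ.+ suc (suc k) * B)
    ≡⟨ cong (A ℕ.+_) (cong₂ ℕ._+_ ([k+1]*[n+1]C[k+1]≡[n+1]*nCk n k)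
                                  ([k+1]*[n+1]C[k+1]≡[n+1]*nCk n (suc k))) ⟩
  A ℕ.+ (suc n * (n C k) ℕ.+ suc n * (n C suc k))
    ≡⟨ cong (A ℕ.+_) (ℕ.*-distribˡ-+ (suc n) (n C k) (n C suc k)) ⟨
  A ℕ.+ suc n * (n C k ℕ.+ n C suc k)
    ≡⟨ cong (λ c → A ℕ.+ suc n * c) (nCk+nC[k+1]≡[n+1]C[k+1] n k) ⟩
  suc (suc n) * A ∎
  where
  open ≡-Reasoning
  A B : ℕ
  A = suc n C suc k
  B = suc n C suc (suc k)
  split : ∀ k a b → suc (suc k) * (a ℕ.+ b) ≡ a ℕ.+ (suc k * a ℕ.+ suc (suc k) * b)
  split = solve 3 (λ k a b → (con 2 :+ k) :* (a :+ b) := a :+ ((con 1 :+ k) :* a :+ (con 2 :+ k) :* b)) refl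
    where open ℕ-Solver

-- Pascal's rule at most doubles the largest entry from one row to the next, starting from 1 in row
-- 1. The exponent is one less than the row, and this saved factor 2 makes the induction for
-- `lcmUpTo≤4^n` close.
[n+1]Ck≤2^n : ∀ n k → suc n C k ℕ.≤ 2 ^ n
[n+1]Ck≤2^n n zero = ℕ.≤-trans (ℕ.≤-reflexive (nC0≡1 (suc n))) (ℕ.m^n>0 2 n)
[n+1]Ck≤2^n zero (suc zero) = ℕ.≤-reflexive (nC1≡n 1)
[n+1]Ck≤2^n zero (suc (suc k)) = ℕ.≤-trans (ℕ.≤-reflexive (k>n⇒nCk≡0 {k = suc (suc k)} (s≤s (s≤s z≤n)))) z≤n
[n+1]Ck≤2^n (suc n) (suc k) = begin
  suc (suc n) C suc k            ≡⟨ nCk+nC[k+1]≡[n+1]C[k+1] (suc n) k ⟨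
  suc n C k ℕ.+ suc n C suc k    ≤⟨ ℕ.+-mono-≤ ([n+1]Ck≤2^n n k) ([n+1]Ck≤2^n n (suc k)) ⟩
  2 ^ n ℕ.+ 2 ^ n                ≡⟨ cong (2 ^ n ℕ.+_) (ℕ.+-identityʳ (2 ^ n)) ⟨
  2 ^ suc n                      ∎
  where open ℕ.≤-Reasoning

k≤n⇒nCk>0 : ∀ {n k} → k ℕ.≤ n → 0 ℕ.< n C k
k≤n⇒nCk>0 {n} z≤n = ℕ.≤-reflexive (sym (nC0≡1 n))
k≤n⇒nCk>0 {suc n} {suc k} (s≤s k≤n) = begin-strict
  0                        <⟨ k≤n⇒nCk>0 k≤n ⟩
  n C k                    ≤⟨ ℕ.m≤m+n (n C k) (n C suc k) ⟩
  n C k ℕ.+ n C suc k      ≡⟨ nCk+nC[k+1]≡[n+1]C[k+1] n k ⟩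
  suc n C suc k            ∎
  where open ℕ.≤-Reasoning

-- Divisibility of differences of binomial coefficients

k+1∣L⇒n+1∣L*[n+1]C[k+1] : ∀ n k {L} → suc k ℕ.∣ L → suc n ℕ.∣ L * (suc n C suc k)
k+1∣L⇒n+1∣L*[n+1]C[k+1] n k {L} (ℕ.divides q L≡q*[k+1]) = ℕ.divides (q * (n C k)) (begin
  L * (suc n C suc k)            ≡⟨ cong (_* (suc n C suc k)) L≡q*[k+1] ⟩
  q * suc k * (suc n C suc k)    ≡⟨ ℕ.*-assoc q (suc k) _ ⟩
  q * (suc k * (suc n C suc k))  ≡⟨ cong (q *_) ([k+1]*[n+1]C[k+1]≡[n+1]*nCk n k) ⟩
  q * (suc n * (n C k))          ≡⟨ rearrange q (suc n) (n C k) ⟩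
  q * (n C k) * suc n            ∎)
  where
  open ≡-Reasoning
  rearrange : ∀ q m c → q * (m * c) ≡ q * c * m
  rearrange = solve 3 (λ q m c → q :* (m :* c) := q :* c :* m) refl
    where open ℕ-Solver

-- Induction on b: by Pascal's rule the difference at (b + 1, k + 1) is the sum of those at (b, k)
-- and (b, k + 1). At b = 0 the subtracted 0 C (k + 1) vanishes and absorption applies. Keeping `L`
-- arbitrary lets one multiplier serve both k and k + 1.
d∣L*Δ[nCk] : ∀ d b k {L} → (∀ i → i ℕ.< k → suc i ℕ.∣ L) →
  + suc d ∣ + L ℤ.* (+ ((b ℕ.+ suc d) C k) - + (b C k))
d∣L*Δ[nCk] d b zero {L} _ = divides 0ℤ (begin
  + L ℤ.* (+ ((b ℕ.+ suc d) C 0) - + (b C 0))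
    ≡⟨ cong₂ (λ p q → + L ℤ.* (+ p - + q)) (nC0≡1 (b ℕ.+ suc d)) (nC0≡1 b) ⟩
  + L ℤ.* 0ℤ
    ≡⟨ ℤ.*-zeroʳ (+ L) ⟩
  0ℤ ∎)
  where open ≡-Reasoning
d∣L*Δ[nCk] d zero (suc k) {L} L-mult =
  subst (+ suc d ∣_) (begin
    + (L * (suc d C suc k))                    ≡⟨ ℤ.pos-* L (suc d C suc k) ⟩
    + L ℤ.* + (suc d C suc k)                  ≡⟨ cong (+ L ℤ.*_) (ℤ.+-identityʳ (+ (suc d C suc k))) ⟨
    + L ℤ.* (+ (suc d C suc k) - 0ℤ)           ≡⟨ cong (λ c → + L ℤ.* (+ (suc d C suc k) - + c))
                                                       (k>n⇒nCk≡0 (s≤s (z≤n {k}))) ⟨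
    + L ℤ.* (+ (suc d C suc k) - + (0 C suc k)) ∎)
  (∣ᵤ⇒∣ (k+1∣L⇒n+1∣L*[n+1]C[k+1] d k (L-mult k ℕ.≤-refl)))
  where open ≡-Reasoning
d∣L*Δ[nCk] d (suc b) (suc k) {L} L-mult =
  subst (+ suc d ∣_) (begin
    + L ℤ.* (+ A - + A′) ℤ.+ + L ℤ.* (+ B - + B′)    ≡⟨ rearrange (+ L) (+ A) (+ A′) (+ B) (+ B′) ⟩
    + L ℤ.* ((+ A ℤ.+ + B) - (+ A′ ℤ.+ + B′))        ≡⟨⟩
    + L ℤ.* (+ (A ℕ.+ B) - + (A′ ℕ.+ B′))            ≡⟨ cong₂ (λ p q → + L ℤ.* (+ p - + q))
                                                          (nCk+nC[k+1]≡[n+1]C[k+1] (b ℕ.+ suc d) k)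
                                                          (nCk+nC[k+1]≡[n+1]C[k+1] b k) ⟩
    + L ℤ.* (+ (suc (b ℕ.+ suc d) C suc k) - + (suc b C suc k)) ∎)
  (∣m∣n⇒∣m+n (d∣L*Δ[nCk] d b k (λ i i<k → L-mult i (ℕ.m<n⇒m<1+n i<k)))
             (d∣L*Δ[nCk] d b (suc k) L-mult))
  where
  open ≡-Reasoning
  A A′ B B′ : ℕ
  A  = (b ℕ.+ suc d) C k
  A′ = b C k
  B  = (b ℕ.+ suc d) C suc k
  B′ = b C suc k
  rearrange : ∀ l a a′ b b′ →
    l ℤ.* (a - a′) ℤ.+ l ℤ.* (b - b′) ≡ l ℤ.* ((a ℤ.+ b) - (a′ ℤ.+ b′))
  rearrange = solve 5 (λ l a a′ b b′ →
    l :* (a :- a′) :+ l :* (b :- b′) := l :* ((a :+ b) :- (a′ :+ b′))) refl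
    where open ℤ-Solver

b<k⇒d∣L*[b+d]Ck : ∀ d b k {L} → b ℕ.< k → (∀ i → i ℕ.< k → suc i ℕ.∣ L) →
  suc d ℕ.∣ L * ((b ℕ.+ suc d) C k)
b<k⇒d∣L*[b+d]Ck d b k {L} b<k L-mult = ∣⇒∣ᵤ (subst (+ suc d ∣_) (begin
    + L ℤ.* (+ A - + (b C k))  ≡⟨ cong (λ c → + L ℤ.* (+ A - + c)) (k>n⇒nCk≡0 b<k) ⟩
    + L ℤ.* (+ A - 0ℤ)         ≡⟨ cong (+ L ℤ.*_) (ℤ.+-identityʳ (+ A)) ⟩
    + L ℤ.* + A                ≡⟨ ℤ.pos-* L A ⟨
    + (L * A)                  ∎)
  (d∣L*Δ[nCk] d b k L-mult))
  where
  open ≡-Reasoning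
  A : ℕ
  A = (b ℕ.+ suc d) C k

-- The bound lcm(n) ≤ 4ⁿ

i<n⇒i+1∣lcmUpTo[n] : ∀ {i n} → i ℕ.< n → suc i ℕ.∣ lcmUpTo n
i<n⇒i+1∣lcmUpTo[n] {i} {suc n} (s≤s i≤n) with ℕ.m≤n⇒m<n∨m≡n i≤n
... | inj₁ i<n  = ℕ.∣-trans (i<n⇒i+1∣lcmUpTo[n] i<n) (n∣lcm[m,n] (suc n) (lcmUpTo n))
... | inj₂ refl = m∣lcm[m,n] (suc n) (lcmUpTo n)

lcmUpTo-least : ∀ n {c} → (∀ i → i ℕ.< n → suc i ℕ.∣ c) → lcmUpTo n ℕ.∣ c
lcmUpTo-least zero    {c} _ = ℕ.1∣ c
lcmUpTo-least (suc n) h =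
  lcm-least (h n ℕ.≤-refl) (lcmUpTo-least n (λ i i<n → h i (ℕ.m<n⇒m<1+n i<n)))

lcmUpTo≢0 : ∀ n → ℕ.NonZero (lcmUpTo n)
lcmUpTo≢0 zero    = _
lcmUpTo≢0 (suc n) = ℕ.m*n≢0⇒n≢0 (gcd (suc n) (lcmUpTo n))
  ⦃ subst ℕ.NonZero (sym (gcd*lcm (suc n) (lcmUpTo n)))
      (ℕ.m*n≢0 (suc n) (lcmUpTo n) ⦃ _ ⦄ ⦃ lcmUpTo≢0 n ⦄) ⦄

lcmUpTo[d+j]∣lcmUpTo[j]*[d+j]Cj : ∀ {d j} → d ℕ.≤ j →
  lcmUpTo (d ℕ.+ j) ℕ.∣ lcmUpTo j * ((d ℕ.+ j) C j)
lcmUpTo[d+j]∣lcmUpTo[j]*[d+j]Cj {d} {j} d≤j = lcmUpTo-least (d ℕ.+ j) step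
  where
  n : ℕ
  n = d ℕ.+ j
  step : ∀ i → i ℕ.< n → suc i ℕ.∣ lcmUpTo j * (n C j)
  -- Divisors i + 1 up to j already divide lcm(j). For the others n = b + (i + 1), where b < j
  -- follows from d ≤ j ≤ i.
  step i i<n with ℕ.<-≤-connex i j
  ... | inj₁ i<j = ℕ.∣m⇒∣m*n (n C j) (i<n⇒i+1∣lcmUpTo[n] i<j)
  ... | inj₂ j≤i = subst (λ m → suc i ℕ.∣ lcmUpTo j * (m C j)) (ℕ.m∸n+n≡m i<n)
    (b<k⇒d∣L*[b+d]Ck i (n ℕ.∸ suc i) j b<j (λ _ → i<n⇒i+1∣lcmUpTo[n]))
    where
    b<j : n ℕ.∸ suc i ℕ.< j
    b<j = ℕ.+-cancelʳ-< (suc i) (n ℕ.∸ suc i) j (begin-strict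
      n ℕ.∸ suc i ℕ.+ suc i  ≡⟨ ℕ.m∸n+n≡m i<n ⟩
      d ℕ.+ j                ≤⟨ ℕ.+-mono-≤ d≤j j≤i ⟩
      j ℕ.+ i                <⟨ ℕ.+-monoʳ-< j (ℕ.n<1+n i) ⟩
      j ℕ.+ suc i            ∎)
      where open ℕ.≤-Reasoning

-- Strong induction through lcm(n) ≤ lcm(j) (n C j) with j = ⌈n/2⌉. The case n = 1 is separate
-- because there j is not smaller than n.
lcmUpTo≤4^n : ∀ n → lcmUpTo n ℕ.≤ 4 ^ n
lcmUpTo≤4^n = <-rec (λ n → lcmUpTo n ℕ.≤ 4 ^ n) bound
  where
  open ℕ.≤-Reasoning
  bound : ∀ n → (∀ {m} → m ℕ.< n → lcmUpTo m ℕ.≤ 4 ^ m) → lcmUpTo n ℕ.≤ 4 ^ n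
  bound 0 _ = ℕ.≤-refl
  bound 1 _ = s≤s z≤n
  bound n@(suc n-1@(suc n-2)) rec = begin
    lcmUpTo n                  ≤⟨ ℕ.∣⇒≤ ⦃ ℕ.m*n≢0 (lcmUpTo j) (n C j) ⦃ lcmUpTo≢0 j ⦄ ⦃ nCj≢0 ⦄ ⦄ divs ⟩
    lcmUpTo j * (n C j)        ≤⟨ ℕ.*-mono-≤ (rec (ℕ.⌈n/2⌉<n n-2)) ([n+1]Ck≤2^n n-1 j) ⟩
    4 ^ j * 2 ^ n-1            ≡⟨ cong (_* 2 ^ n-1) (ℕ.^-*-assoc 2 2 j) ⟩
    2 ^ (2 * j) * 2 ^ n-1      ≡⟨ ℕ.^-distribˡ-+-* 2 (2 * j) n-1 ⟨
    2 ^ (2 * j ℕ.+ n-1)        ≤⟨ ℕ.^-monoʳ-≤ 2 exponent ⟩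
    2 ^ (2 * n)                ≡⟨ ℕ.^-*-assoc 2 2 n ⟨
    4 ^ n                      ∎
    where
    j : ℕ
    j = ⌈ n /2⌉
    divs : lcmUpTo n ℕ.∣ lcmUpTo j * (n C j)
    divs = subst (λ m → lcmUpTo m ℕ.∣ lcmUpTo j * (m C j)) (ℕ.⌊n/2⌋+⌈n/2⌉≡n n)
      (lcmUpTo[d+j]∣lcmUpTo[j]*[d+j]Cj (ℕ.⌊n/2⌋≤⌈n/2⌉ n))
    nCj≢0 : ℕ.NonZero (n C j)
    nCj≢0 = ℕ.>-nonZero (k≤n⇒nCk>0 (ℕ.⌈n/2⌉≤n n))
    exponent : 2 * j ℕ.+ n-1 ℕ.≤ 2 * n
    -- `⌈ n /2⌉` is by definition `⌊ suc n /2⌋`, so 2 j ≤ n + 1. For odd n the whole estimate is an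
    -- equality.
    exponent = begin
      2 * j ℕ.+ n-1                      ≡⟨ cong (λ i → j ℕ.+ i ℕ.+ n-1) (ℕ.+-identityʳ j) ⟩
      ⌊ suc n /2⌋ ℕ.+ j ℕ.+ n-1          ≤⟨ ℕ.+-monoˡ-≤ n-1 (ℕ.+-monoʳ-≤ j (ℕ.⌊n/2⌋≤⌈n/2⌉ (suc n))) ⟩
      ⌊ suc n /2⌋ ℕ.+ ⌈ suc n /2⌉ ℕ.+ n-1 ≡⟨ cong (ℕ._+ n-1) (ℕ.⌊n/2⌋+⌈n/2⌉≡n (suc n)) ⟩
      suc n ℕ.+ n-1                      ≡⟨ ℕ.+-suc n n-1 ⟨
      n ℕ.+ n                            ≡⟨ cong (n ℕ.+_) (ℕ.+-identityʳ n) ⟨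
      2 * n                              ∎

-- Approximation by a function with integral difference ratios

-- Swapping the two arguments negates both the divisor and the difference, so positive increments
-- `suc d` suffice.
increments⇒IDR : ∀ (u : ℕ → ℤ) → (∀ d b → + suc d ∣ u (b ℕ.+ suc d) - u b) →
  IntegralDifferenceRatios u
increments⇒IDR u h a b a≢b with ℕ.<-cmp a b
... | tri≈ _ a≡b _ = contradiction a≡b a≢b
... | tri> _ _ b<a with ℕ.m≤n⇒∃[o]m+o≡n b<a
...   | d , refl = subst₂ (λ m k → m ∣ u k - u b) (gap (+ b) (+ d)) (ℕ.+-suc b d) (h d b)
  where
  gap : ∀ b d → ℤ.1ℤ ℤ.+ d ≡ (ℤ.1ℤ ℤ.+ (b ℤ.+ d)) - b
  gap = solve 2 (λ b d → con ℤ.1ℤ :+ d := (con ℤ.1ℤ :+ (b :+ d)) :- b) refl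
    where open ℤ-Solver
increments⇒IDR u h a b a≢b | tri< a<b _ _ with ℕ.m≤n⇒∃[o]m+o≡n a<b
... | d , refl with subst (λ k → + suc d ∣ u k - u a) (ℕ.+-suc a d) (h d a)
...   | divides q u[b]-u[a]≡q*[d+1] = divides q (begin
  u a - u b                                    ≡⟨ swap (u a) (u b) ⟩
  ℤ.- (u b - u a)                              ≡⟨ cong ℤ.-_ u[b]-u[a]≡q*[d+1] ⟩
  ℤ.- (q ℤ.* (ℤ.1ℤ ℤ.+ + d))                   ≡⟨ gap q (+ a) (+ d) ⟩
  q ℤ.* (+ a - + b)                            ∎)
  where
  open ≡-Reasoning
  open ℤ-Solver
  swap : ∀ x y → x - y ≡ ℤ.- (y - x)
  swap = solve 2 (λ x y → x :- y := :- (y :- x)) refl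
  gap : ∀ q a d → ℤ.- (q ℤ.* (ℤ.1ℤ ℤ.+ d)) ≡ q ℤ.* (a - (ℤ.1ℤ ℤ.+ (a ℤ.+ d)))
  gap = solve 3 (λ q a d → :- (q :* (con ℤ.1ℤ :+ d)) := q :* (a :- (con ℤ.1ℤ :+ (a :+ d)))) refl

newtonTerm-IDR : ∀ q k → IntegralDifferenceRatios (λ n → q ℤ.* + lcmUpTo k ℤ.* + (n C k))
newtonTerm-IDR q k = increments⇒IDR (λ n → q ℤ.* + lcmUpTo k ℤ.* + (n C k)) λ d b → subst (+ suc d ∣_)
  (factor q (+ lcmUpTo k) (+ ((b ℕ.+ suc d) C k)) (+ (b C k)))
  (∣n⇒∣m*n q (d∣L*Δ[nCk] d b k (λ _ → i<n⇒i+1∣lcmUpTo[n])))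
  where
  factor : ∀ q l x y → q ℤ.* (l ℤ.* (x - y)) ≡ q ℤ.* l ℤ.* x - q ℤ.* l ℤ.* y
  factor = solve 4 (λ q l x y → q :* (l :* (x :- y)) := q :* l :* x :- q :* l :* y) refl
    where open ℤ-Solver

-- Greedy Newton expansion

_/lcm_ : ℤ → ℕ → ℤ
z /lcm k = (z /ℕ lcmUpTo k) ⦃ lcmUpTo≢0 k ⦄

-- Division rounds down even for negative `z`, so the remainder always lies in [0, lcm(k)); this
-- puts g below f.
_%lcm_ : ℤ → ℕ → ℕ
z %lcm k = (z %ℕ lcmUpTo k) ⦃ lcmUpTo≢0 k ⦄

module Newton (f : ℕ → ℤ) where

  -- What is left of f after the first k Newton terms. The coefficient of n C k is the greatest
  -- multiple of lcm(k) not exceeding the current residue at k.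
  residue : ℕ → ℕ → ℤ
  residue zero    n = f n
  residue (suc k) n =
    residue k n - (residue k k /lcm k) ℤ.* + lcmUpTo k ℤ.* + (n C k)

  -- The terms with k > n vanish at n, so this is the full Newton series.
  approximant : ℕ → ℤ
  approximant n = f n - residue (suc n) n

  partialSum-IDR : ∀ k → IntegralDifferenceRatios (λ n → f n - residue k n)
  partialSum-IDR zero    a b _   = divides 0ℤ (begin
    (f a - f a) - (f b - f b)  ≡⟨ cong₂ _-_ (ℤ.+-inverseʳ (f a)) (ℤ.+-inverseʳ (f b)) ⟩
    0ℤ                         ∎)
    where open ≡-Reasoning
  partialSum-IDR (suc k) a b a≢b = subst (+ a - + b ∣_)
    (rearrange (f a) (residue k a) (t a) (f b) (residue k b) (t b))
    (∣m∣n⇒∣m+n (partialSum-IDR k a b a≢b) (newtonTerm-IDR (residue k k /lcm k) k a b a≢b))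
    where
    t : ℕ → ℤ
    t n = (residue k k /lcm k) ℤ.* + lcmUpTo k ℤ.* + (n C k)
    rearrange : ∀ x r s y r′ s′ →
      ((x - r) - (y - r′)) ℤ.+ (s - s′) ≡ (x - (r - s)) - (y - (r′ - s′))
    rearrange = solve 6 (λ x r s y r′ s′ →
      ((x :- r) :- (y :- r′)) :+ (s :- s′) := (x :- (r :- s)) :- (y :- (r′ :- s′))) refl
      where open ℤ-Solver

  residue-stable : ∀ {k n} → suc n ℕ.≤′ k → residue k n ≡ residue (suc n) n
  residue-stable (ℕ.≤′-reflexive refl) = refl
  residue-stable {suc k} {n} (ℕ.≤′-step n<k) = begin
    residue k n - c ℤ.* + (n C k)    ≡⟨ cong (λ m → residue k n - c ℤ.* + m) (k>n⇒nCk≡0 (ℕ.≤′⇒≤ n<k)) ⟩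
    residue k n - c ℤ.* 0ℤ           ≡⟨ cong (residue k n -_) (ℤ.*-zeroʳ c) ⟩
    residue k n - 0ℤ                 ≡⟨ ℤ.+-identityʳ (residue k n) ⟩
    residue k n                      ≡⟨ residue-stable n<k ⟩
    residue (suc n) n                ∎
    where
    open ≡-Reasoning
    c : ℤ
    c = (residue k k /lcm k) ℤ.* + lcmUpTo k

  -- The cutoff in `approximant` moves with its argument. By `residue-stable`, both a and b may be
  -- evaluated in the single partial sum cut off after max(a, b).
  approximant-IDR : IntegralDifferenceRatios approximant
  approximant-IDR a b a≢b = subst (+ a - + b ∣_)
    (cong₂ (λ r s → (f a - r) - (f b - s))
      (residue-stable (ℕ.≤⇒≤′ (s≤s (ℕ.m≤m⊔n a b))))
      (residue-stable (ℕ.≤⇒≤′ (s≤s (ℕ.m≤n⊔m a b)))))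
    (partialSum-IDR (suc (a ℕ.⊔ b)) a b a≢b)

  -- As n C n = 1, the n-th term subtracts exactly the chosen multiple of lcm(n) and leaves the
  -- remainder.
  f-approximant≡residue% : ∀ n → f n - approximant n ≡ + (residue n n %lcm n)
  f-approximant≡residue% n = begin
    f n - (f n - residue (suc n) n)   ≡⟨ cancel (f n) (residue (suc n) n) ⟩
    r - c ℤ.* + (n C n)               ≡⟨ cong (λ m → r - c ℤ.* + m) (nCn≡1 n) ⟩
    r - c ℤ.* ℤ.1ℤ                    ≡⟨ cong (r -_) (ℤ.*-identityʳ c) ⟩
    r - c                             ≡⟨ cong (_- c) (a≡a%ℕn+[a/ℕn]*n r (lcmUpTo n) ⦃ lcmUpTo≢0 n ⦄) ⟩
    (+ (r %lcm n) ℤ.+ c) - c    ≡⟨ cancelʳ (+ (r %lcm n)) c ⟩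
    + (r %lcm n)                ∎
    where
    open ≡-Reasoning
    open ℤ-Solver
    r c : ℤ
    r = residue n n
    c = (r /lcm n) ℤ.* + lcmUpTo n
    cancel : ∀ x y → x - (x - y) ≡ y
    cancel = solve 2 (λ x y → x :- (x :- y) := y) refl
    cancelʳ : ∀ x y → (x ℤ.+ y) - y ≡ x
    cancelʳ = solve 2 (λ x y → (x :+ y) :- y := x) refl

  0≤f-approximant : ∀ n → 0ℤ ≤ f n - approximant n
  0≤f-approximant n = subst (0ℤ ≤_) (sym (f-approximant≡residue% n)) (ℤ.+≤+ z≤n)

  f-approximant≤lcmUpTo : ∀ n → f n - approximant n ≤ + lcmUpTo n
  f-approximant≤lcmUpTo n = subst (_≤ + lcmUpTo n) (sym (f-approximant≡residue% n))
    (ℤ.+≤+ (ℕ.<⇒≤ (n%ℕd<d (residue n n) (lcmUpTo n) ⦃ lcmUpTo≢0 n ⦄)))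

-- Asymptotic equivalence

fromℤ-homo-* : ∀ i j → fromℤ i ℚ.* fromℤ j ≡ fromℤ (i ℤ.* j)
fromℤ-homo-* i j = ℚ.toℚᵘ-injective
  (ℚᵘ.≃-trans (ℚ.toℚᵘ-homo-* (fromℤ i) (fromℤ j)) (ℚᵘ.*≡* refl))

fromℤ-homo-+ : ∀ i j → fromℤ i ℚ.+ fromℤ j ≡ fromℤ (i ℤ.+ j)
fromℤ-homo-+ i j = ℚ.toℚᵘ-injective
  (ℚᵘ.≃-trans (ℚ.toℚᵘ-homo-+ (fromℤ i) (fromℤ j))
    (ℚᵘ.*≡* (cong (ℤ._* ℤ.1ℤ) (cong₂ ℤ._+_ (ℤ.*-identityʳ i) (ℤ.*-identityʳ j)))))

fromℤ-cancel-≤ : ∀ {i j} → fromℤ i ℚ.≤ fromℤ j → i ≤ j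
fromℤ-cancel-≤ {i} {j} i≤j = subst₂ _≤_ (ℤ.*-identityʳ i) (ℤ.*-identityʳ j) (ℚ.drop-*≤* i≤j)

fromℤ-neg : ∀ i → ℚ.- fromℤ i ≡ fromℤ (ℤ.- i)
fromℤ-neg (+ zero)    = refl
fromℤ-neg ℤ.+[1+ _ ]  = refl
fromℤ-neg ℤ.-[1+ _ ]  = refl

fromℤ-nonZero : ∀ i .⦃ _ : ℤ.NonZero i ⦄ → ℚ.NonZero (fromℤ i)
fromℤ-nonZero ℤ.+[1+ _ ] = _
fromℤ-nonZero ℤ.-[1+ _ ] = _

∣fromℤ∣ : ∀ i → ℚ.∣ fromℤ i ∣ ≡ fromℤ (+ ∣ i ∣)
∣fromℤ∣ (+ _)         = refl
∣fromℤ∣ ℤ.-[1+ _ ]    = refl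

-- Comparison of (2e + ε)ˣ with 5ˣ

c≤x⇒c^k≤x^k : ∀ x {c n} k → fromℤ (+ c) ℚ.≤ approx x n → fromℤ (+ (c ^ k)) ℚ.≤ approx (x ^ℝ k) n
c≤x⇒c^k≤x^k x zero c≤x = ℚ.≤-refl
c≤x⇒c^k≤x^k x {c} {n} (suc k) c≤x = begin
  fromℤ (+ (c * c ^ k))               ≡⟨ cong fromℤ (ℤ.pos-* c (c ^ k)) ⟩
  fromℤ (+ c ℤ.* + (c ^ k))           ≡⟨ fromℤ-homo-* (+ c) (+ (c ^ k)) ⟨
  fromℤ (+ c) ℚ.* fromℤ (+ (c ^ k))   ≤⟨ ℚ.*-monoʳ-≤-nonNeg (fromℤ (+ (c ^ k))) c≤x ⟩
  approx x n ℚ.* fromℤ (+ (c ^ k))    ≤⟨ ℚ.*-monoˡ-≤-nonNeg (approx x n)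
                                           ⦃ ℚ.nonNegative (ℚ.≤-trans (ℚ.nonNegative⁻¹ (fromℤ (+ c))) c≤x) ⦄
                                           (c≤x⇒c^k≤x^k x k c≤x) ⟩
  approx (x ^ℝ suc k) n               ∎
  where open ℚ.≤-Reasoning

-- The partial sum 1 + 1 + 1/2 is already 5/2, and later terms are nonnegative.
5/2≤expSum : ∀ n → (+ 5) ℚ./ 2 ℚ.≤ expSum (2 ℕ.+ n)
5/2≤expSum zero    = ℚ.≤-refl
5/2≤expSum (suc n) = begin
  (+ 5) ℚ./ 2                            ≤⟨ 5/2≤expSum n ⟩
  expSum (2 ℕ.+ n)                       ≡⟨ ℚ.+-identityʳ (expSum (2 ℕ.+ n)) ⟨
  expSum (2 ℕ.+ n) ℚ.+ 0ℚ                ≤⟨ ℚ.+-monoʳ-≤ (expSum (2 ℕ.+ n)) (ℚ.nonNegative⁻¹ (inv! (3 ℕ.+ n))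
                                              ⦃ ℚ.normalize-nonNeg 1 ((3 ℕ.+ n) !) ⦃ (3 ℕ.+ n) ℕ.!≢0 ⦄ ⦄) ⟩
  expSum (3 ℕ.+ n)                       ∎
  where open ℚ.≤-Reasoning

5≤2e+ε : ∀ {ε} → 0ℝ <ℝ ε → Eventually (λ n → fromℤ (+ 5) ℚ.≤ approx (2ℝ *ℝ e +ℝ ε) n)
5≤2e+ε {ε} (δ , 0<δ , N , δ≤ε) = 2 ℕ.+ N , bound
  where
  open ℚ.≤-Reasoning
  bound : ∀ n → 2 ℕ.+ N ℕ.≤ n → fromℤ (+ 5) ℚ.≤ approx (2ℝ *ℝ e +ℝ ε) n
  bound 1 (s≤s ())
  bound n@(suc (suc n-2)) 2+N≤n = begin
    -- The left-hand side computes to 5. Index 2 is needed for the partial sum of e, index N for the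
    -- positivity of ε.
    fromℤ (+ 2) ℚ.* ((+ 5) ℚ./ 2) ℚ.+ 0ℚ   ≤⟨ ℚ.+-mono-≤
                                               (ℚ.*-monoˡ-≤-nonNeg (fromℤ (+ 2)) (5/2≤expSum n-2))
                                               0≤ε ⟩
    approx (2ℝ *ℝ e +ℝ ε) n                ∎
    where
    0≤ε : 0ℚ ℚ.≤ approx ε n
    0≤ε = begin
      0ℚ             ≤⟨ ℚ.<⇒≤ 0<δ ⟩
      δ              ≡⟨ ℚ.+-identityˡ δ ⟨
      0ℚ ℚ.+ δ       ≤⟨ δ≤ε n (ℕ.≤-trans (ℕ.m≤n+m N 2) 2+N≤n) ⟩
      approx ε n     ∎

-- The real inequality is read at one index with tolerance 1, whence `suc k`. Real powers are
-- computed index by index, so the bound 5 on the base carries over to the power at that index.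
[2e+ε]^x≤k⇒5^x≤k+1 : ∀ {ε} x k → 0ℝ <ℝ ε → (2ℝ *ℝ e +ℝ ε) ^ℝ x ≤ℝ fromℤℝ (+ k) → 5 ^ x ℕ.≤ suc k
[2e+ε]^x≤k⇒5^x≤k+1 {ε} x k 0<ε le =
  let (M , 5≤) = 5≤2e+ε {ε} 0<ε
      (N , ≤k) = le 1ℚ (ℚ.positive⁻¹ 1ℚ)
      n        = M ℕ.⊔ N
  in ℕ.≤-trans (ℤ.drop‿+≤+ (fromℤ-cancel-≤ (begin
    fromℤ (+ (5 ^ x))                      ≤⟨ c≤x⇒c^k≤x^k (2ℝ *ℝ e +ℝ ε) x (5≤ n (ℕ.m≤m⊔n M N)) ⟩
    approx ((2ℝ *ℝ e +ℝ ε) ^ℝ x) n         ≤⟨ ≤k n (ℕ.m≤n⊔m M N) ⟩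
    fromℤ (+ k) ℚ.+ fromℤ ℤ.1ℤ             ≡⟨ fromℤ-homo-+ (+ k) ℤ.1ℤ ⟩
    fromℤ (+ (k ℕ.+ 1))                    ∎)))
    (ℕ.≤-reflexive (ℕ.+-comm k 1))
  where open ℚ.≤-Reasoning

-- Bernoulli's inequality for (5/4)ˣ ≥ 1 + x/4, cleared of denominators.
[4+x]*4^x≤4*5^x : ∀ x → (4 ℕ.+ x) * 4 ^ x ℕ.≤ 4 * 5 ^ x
[4+x]*4^x≤4*5^x zero    = ℕ.≤-refl
[4+x]*4^x≤4*5^x (suc x) = begin
  -- The added slack makes the coefficient a multiple of 5: 4 (5 + x) + x = 5 (4 + x).
  (5 ℕ.+ x) * (4 * 4 ^ x)                    ≤⟨ ℕ.m≤m+n _ (x * 4 ^ x) ⟩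
  (5 ℕ.+ x) * (4 * 4 ^ x) ℕ.+ x * 4 ^ x      ≡⟨ regroup x (4 ^ x) ⟩
  5 * ((4 ℕ.+ x) * 4 ^ x)                    ≤⟨ ℕ.*-monoʳ-≤ 5 ([4+x]*4^x≤4*5^x x) ⟩
  5 * (4 * 5 ^ x)                            ≡⟨ swap (5 ^ x) ⟩
  4 * (5 * 5 ^ x)                            ∎
  where
  open ℕ.≤-Reasoning
  open ℕ-Solver
  regroup : ∀ x p → (5 ℕ.+ x) * (4 * p) ℕ.+ x * p ≡ 5 * ((4 ℕ.+ x) * p)
  regroup = solve 2 (λ x p →
    (con 5 :+ x) :* (con 4 :* p) :+ x :* p := con 5 :* ((con 4 :+ x) :* p)) refl
  swap : ∀ p → 5 * (4 * p) ≡ 4 * (5 * p)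
  swap = solve 1 (λ p → con 5 :* (con 4 :* p) := con 4 :* (con 5 :* p)) refl

4c≤x⇒[1+c]*4^x≤5^x : ∀ c x → 4 * c ℕ.≤ x → suc c * 4 ^ x ℕ.≤ 5 ^ x
4c≤x⇒[1+c]*4^x≤5^x c x 4c≤x = ℕ.*-cancelˡ-≤ 4 (begin
  4 * (suc c * 4 ^ x)     ≡⟨ regroup c (4 ^ x) ⟩
  (4 ℕ.+ 4 * c) * 4 ^ x   ≤⟨ ℕ.*-monoˡ-≤ (4 ^ x) (ℕ.+-monoʳ-≤ 4 4c≤x) ⟩
  (4 ℕ.+ x) * 4 ^ x       ≤⟨ [4+x]*4^x≤4*5^x x ⟩
  4 * 5 ^ x               ∎)
  where
  open ℕ.≤-Reasoning
  regroup : ∀ c p → 4 * (suc c * p) ≡ (4 ℕ.+ 4 * c) * p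
  regroup = solve 2 (λ c p → con 4 :* ((con 1 :+ c) :* p) := (con 4 :+ con 4 :* c) :* p) refl
    where open ℕ-Solver

-- Multiplying |i/j - 1| < (a + 1)/(d + 1) by |j| and clearing the denominator leaves the integer
-- inequality assumed here.
÷ℤ-close : ∀ {a d} .{c : Coprime (suc a) (suc d)} i j .⦃ _ : ℤ.NonZero j ⦄ → ∣ i - j ∣ * suc d ℕ.< suc a * ∣ j ∣ →
  ℚ.∣ i ÷ℤ j ℚ.- 1ℚ ∣ ℚ.< mkℚ ℤ.+[1+ a ] d c
÷ℤ-close {a} {d} {c} i j lt = ℚ.*-cancelʳ-<-nonNeg (fromℤ (+ ∣ j ∣)) (begin-strict
  ℚ.∣ i ÷ℤ j ℚ.- 1ℚ ∣ ℚ.* fromℤ (+ ∣ j ∣)   ≡⟨ cong (ℚ.∣ i ÷ℤ j ℚ.- 1ℚ ∣ ℚ.*_) (∣fromℤ∣ j) ⟨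
  ℚ.∣ i ÷ℤ j ℚ.- 1ℚ ∣ ℚ.* ℚ.∣ q ∣           ≡⟨ ℚ.∣p*q∣≡∣p∣*∣q∣ (i ÷ℤ j ℚ.- 1ℚ) q ⟨
  ℚ.∣ (i ÷ℤ j ℚ.- 1ℚ) ℚ.* q ∣               ≡⟨ cong ℚ.∣_∣ clear ⟩
  ℚ.∣ fromℤ (i - j) ∣                       ≡⟨ ∣fromℤ∣ (i - j) ⟩
  fromℤ (+ ∣ i - j ∣)                       <⟨ ℚ.toℚᵘ-cancel-< (ℚᵘ.<-respʳ-≃ (ℚᵘ.≃-sym (ℚ.toℚᵘ-homo-* δ (fromℤ (+ ∣ j ∣)))) (ℚᵘ.*<* numerators)) ⟩
  δ ℚ.* fromℤ (+ ∣ j ∣)                     ∎)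
  where
  open ℚ.≤-Reasoning
  δ p q : ℚ
  δ = mkℚ ℤ.+[1+ a ] d c
  p = fromℤ i
  q = fromℤ j
  instance
    q≢0 : ℚ.NonZero q
    q≢0 = fromℤ-nonZero j
  clear : (i ÷ℤ j ℚ.- 1ℚ) ℚ.* q ≡ fromℤ (i - j)
  clear = begin-equality
    (p ℚ.* ℚ.1/ q ℚ.- 1ℚ) ℚ.* q              ≡⟨ expand p (ℚ.1/ q) q ⟩
    p ℚ.* (ℚ.1/ q ℚ.* q) ℚ.+ ℚ.- q           ≡⟨ cong (λ r → p ℚ.* r ℚ.+ ℚ.- q) (ℚ.*-inverseˡ q) ⟩
    p ℚ.* 1ℚ ℚ.+ ℚ.- q                       ≡⟨ cong₂ ℚ._+_ (ℚ.*-identityʳ p) (fromℤ-neg j) ⟩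
    p ℚ.+ fromℤ (ℤ.- j)                      ≡⟨ fromℤ-homo-+ i (ℤ.- j) ⟩
    fromℤ (i - j)                            ∎
    where
    open ℚ-Solver
    expand : ∀ x y z → (x ℚ.* y ℚ.- 1ℚ) ℚ.* z ≡ x ℚ.* (y ℚ.* z) ℚ.+ ℚ.- z
    expand = solve 3 (λ x y z → (x :* y :- con 1ℚ) :* z := x :* (y :* z) :+ (:- z)) refl
  -- `suc (d * 1)` is the denominator of the unnormalised product of δ with an integer, and the
  -- final 1 that of `∣ i - j ∣`.
  numerators : + ∣ i - j ∣ ℤ.* + suc (d * 1) ℤ.< (ℤ.+[1+ a ] ℤ.* + ∣ j ∣) ℤ.* ℤ.1ℤ
  numerators = subst₂ ℤ._<_
    (trans (cong (λ m → + (∣ i - j ∣ * suc m)) (sym (ℕ.*-identityʳ d))) (ℤ.pos-* ∣ i - j ∣ (suc (d * 1))))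
    (trans (ℤ.pos-* (suc a) ∣ j ∣) (sym (ℤ.*-identityʳ _)))
    (ℤ.+<+ lt)

4^x-close⇒asymptotic : ∀ {f g} → (∀ x → ∣ f x - g x ∣ ℕ.≤ 4 ^ x) →
  Eventually (λ x → 5 ^ x ℕ.≤ suc ∣ f x ∣) → AsymptoticallyEquivalent f g
4^x-close⇒asymptotic _ _ (mkℚ (+ zero) _ _) (ℚ.*<* (ℤ.+<+ ()))
4^x-close⇒asymptotic _ _ (mkℚ ℤ.-[1+ _ ] _ _) (ℚ.*<* ())
4^x-close⇒asymptotic {f} {g} close (N , large) δ@(mkℚ ℤ.+[1+ a ] d _) _ =
  -- Beyond this point 5ˣ contains 4 + d copies of 4ˣ: 1 + d bound the scaled error, one gives
  -- strictness, one pays for passing from |f| to |g|, and one absorbs the 1 in `suc ∣ f x ∣`.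
  N ℕ.⊔ 4 * (3 ℕ.+ d) , λ x N≤x →
    let gap = |f-g|*[1+d]<|g| x (large x (ℕ.m⊔n≤o⇒m≤o N _ N≤x)) (ℕ.m⊔n≤o⇒n≤o N _ N≤x)
        -- The strict gap also shows g(x) ≠ 0, so the quotient is defined.
        nz  = ℕ.>-nonZero (ℕ.≤-<-trans z≤n gap)
    in nz , ÷ℤ-close (f x) (g x) ⦃ nz ⦄ (ℕ.<-≤-trans gap (ℕ.m≤n*m ∣ g x ∣ (suc a)))
  where
  open ℕ.≤-Reasoning
  |f-g|*[1+d]<|g| : ∀ x → 5 ^ x ℕ.≤ suc ∣ f x ∣ → 4 * (3 ℕ.+ d) ℕ.≤ x →
    ∣ f x - g x ∣ * suc d ℕ.< ∣ g x ∣
  |f-g|*[1+d]<|g| x 5^x≤ x≥ = ℕ.<-≤-trans (begin-strict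
      ∣ f x - g x ∣ * suc d    ≤⟨ ℕ.*-monoˡ-≤ (suc d) (close x) ⟩
      p * suc d                ≡⟨ ℕ.*-comm p (suc d) ⟩
      suc d * p                <⟨ ℕ.m<n+m (suc d * p) p>0 ⟩
      (2 ℕ.+ d) * p            ∎)
    (ℕ.+-cancelʳ-≤ (2 * p) ((2 ℕ.+ d) * p) ∣ g x ∣ (begin
      (2 ℕ.+ d) * p ℕ.+ 2 * p              ≡⟨ ℕ.*-distribʳ-+ p (2 ℕ.+ d) 2 ⟨
      (2 ℕ.+ d ℕ.+ 2) * p                  ≡⟨ cong (_* p) (ℕ.+-comm (2 ℕ.+ d) 2) ⟩
      (4 ℕ.+ d) * p                        ≤⟨ 4c≤x⇒[1+c]*4^x≤5^x (3 ℕ.+ d) x x≥ ⟩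
      5 ^ x                                ≤⟨ 5^x≤ ⟩
      suc ∣ f x ∣                          ≡⟨ cong (λ z → suc ∣ z ∣) (split (f x) (g x)) ⟩
      suc ∣ g x ℤ.+ (f x - g x) ∣          ≤⟨ s≤s (ℤ.∣i+j∣≤∣i∣+∣j∣ (g x) (f x - g x)) ⟩
      suc (∣ g x ∣ ℕ.+ ∣ f x - g x ∣)      ≤⟨ s≤s (ℕ.+-monoʳ-≤ ∣ g x ∣ (close x)) ⟩
      suc (∣ g x ∣ ℕ.+ p)                  ≡⟨ ℕ.+-suc ∣ g x ∣ p ⟨
      ∣ g x ∣ ℕ.+ suc p                    ≤⟨ ℕ.+-monoʳ-≤ ∣ g x ∣ (ℕ.+-monoˡ-≤ p p>0) ⟩
      ∣ g x ∣ ℕ.+ (p ℕ.+ p)                ≡⟨ cong (λ q → ∣ g x ∣ ℕ.+ (p ℕ.+ q)) (ℕ.+-identityʳ p) ⟨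
      ∣ g x ∣ ℕ.+ 2 * p                    ∎))
    where
    p : ℕ
    p = 4 ^ x
    p>0 : 0 ℕ.< p
    p>0 = ℕ.m^n>0 4 x
    split : ∀ y z → y ≡ z ℤ.+ (y - z)
    split = solve 2 (λ y z → y := z :+ (y :- z)) refl
      where open ℤ-Solver

theorem3p15 : (f : ℕ → ℤ) →
    Σ[ g ∈ (ℕ → ℤ) ]
    ( IntegralDifferenceRatios g
    × (∀ (x : ℕ) → 0ℤ ≤ f x - g x × f x - g x ≤ + (2 ^ x * lcmUpTo x))
    × ( ∃[ ε ] (0ℝ <ℝ ε
    × Eventually (λ x → (2ℝ *ℝ e +ℝ ε) ^ℝ x ≤ℝ fromℤℝ (+ ∣ f x ∣)))
    → AsymptoticallyEquivalent f g ) )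
theorem3p15 f = approximant , approximant-IDR , bounds , λ (ε , 0<ε , N , f-large) →
  4^x-close⇒asymptotic {f} {approximant} close
    (N , λ x N≤x → [2e+ε]^x≤k⇒5^x≤k+1 {ε} x ∣ f x ∣ 0<ε (f-large x N≤x))
  where
  open Newton f
  bounds : ∀ x → 0ℤ ≤ f x - approximant x × f x - approximant x ≤ + (2 ^ x * lcmUpTo x)
  bounds x = 0≤f-approximant x
    , ℤ.≤-trans (f-approximant≤lcmUpTo x) (ℤ.+≤+ (ℕ.m≤n*m (lcmUpTo x) (2 ^ x) ⦃ ℕ.m^n≢0 2 x ⦄))
  close : ∀ x → ∣ f x - approximant x ∣ ℕ.≤ 4 ^ x
  -- The error is measured by lcm(x) ≤ 4ˣ. Estimating it by 2ˣ lcm(x) instead would give 8ˣ, too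
  -- large to compare with 5ˣ.
  close x = ℕ.≤-trans
    (ℤ.drop‿+≤+ (subst (_≤ + lcmUpTo x) (sym (ℤ.0≤i⇒+∣i∣≡i (0≤f-approximant x))) (f-approximant≤lcmUpTo x)))
    (lcmUpTo≤4^n x)
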